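{- Let $p>3$ be a prime and $E$ a supersingular elliptic curve over $\mathbb{F}_{p^2}$ whose endomorphism ring corresponds under the Brandt--Sohn correspondence to a ternary quadratic form $F$ of discriminant $p$ (i.e. $\operatorname{End}(E)\cong\operatorname{Clf}^0(F)$). Let $c$ be a prime with $c<3p/16$. Then $F$ properly represents $2c$ if and only if $E$ is $\mathbb{Z}[\sqrt{ -cp}]$-oriented or $\mathbb{Z}[\frac{1+\sqrt{ -cp}}{2}]$-oriented.
   Context: For an imaginary quadratic order $O$, $E$ is $O$-oriented if there is an injective ring homomorphism $O\hookrightarrow\operatorname{End}(E)$ (for $O=\mathbb{Z}[\sqrt{ -cp}]$ or $\mathbb{Z}[\frac{1+\sqrt{ -cp}}2]$ this is equivalent to the existence of a $c$-isogeny $E\to E^p$, where $E^p$ is obtained by raising the coefficients of $E$ to the $p$-th power). Write $F(x,y,z)=2ax^2+2by^2+2cz^2+2uyz+2vxz+2wxy$ (integers), with discriminant $4abc+uvw-au^2-bv^2-cw^2$. $\operatorname{Clf}^0(F)=\mathbb{Z}+\mathbb{Z}i+\mathbb{Z}j+\mathbb{Z}k\subset B_{p,\infty}$ with $i^2=ui-bc$, $j^2=vj-ac$, $k^2=wk-ab$, $jk=a(u-i)$, $ki=b(v-j)$, $ij=c(w-k)$; $B_{p,\infty}$ is the quaternion algebra over $\mathbb{Q}$ ramified exactly at $p,\infty$. $F$ properly represents $n$ if $F(v)=n$ for some $v\in\mathbb{Z}^3$ with coprime entries. -}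

module Defs where

open import Level using (Level; _⊔_; 0ℓ) renaming (suc to lsuc)
open import Algebra.Bundles using (CommutativeRing; RawMonoid; RawRing; Semiring)
open import Algebra.Morphism.Structures using (module RingMorphisms)
open import Algebra.Solver.Ring.AlmostCommutativeRing
  using (fromCommutativeRing; _-Raw-AlmostCommutative⟶_)
import Algebra.Definitions.RawMonoid
import Algebra.Properties.AbelianGroup
import Algebra.Properties.Group
import Algebra.Properties.Ring
import Algebra.Properties.Semiring.Exp
import Algebra.Properties.Semiring.Mult
import Algebra.Solver.Ring
import Relation.Binary.Reasoning.Setoid
open import Data.Fin.Base using (Fin; toℕ)
open import Data.Fin.Patterns using (0F; 1F; 2F)
open import Data.Integer.Base as ℤ using (ℤ; +_; -[1+_])
import Data.Integer.GCD as ℤ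
import Data.Integer.Properties as ℤ
open import Data.List.Base using (List; []; _∷_)
open import Data.Maybe.Base using (just; nothing)
open import Data.Nat.Base as ℕ using (ℕ; zero; suc)
open import Data.Nat.Divisibility using (_∣_; quotient)
import Data.Nat.Properties as ℕ
open import Data.Product.Base using (Σ; ∃; _×_; _,_; proj₁; proj₂)
open import Data.Sign.Base as Sign using (Sign)
open import Data.Vec.Functional using (Vector)
open import Function.Base using (_∘_)
open import Relation.Binary.Definitions using (Decidable; WeaklyDecidable)
open import Relation.Binary.PropositionalEquality.Core as ≡ using (_≡_)
open import Relation.Nullary using (¬_; yes; no)

------------------------------------------------------------------------
-- Fields

-- The standard library has Heyting fields only; here apartness is the
-- negation of a decidable equality.
record DiscreteField (κ ℓ : Level) : Set (lsuc (κ ⊔ ℓ)) where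
  field
    commutativeRing : CommutativeRing κ ℓ
  open CommutativeRing commutativeRing public
  field
    _≟_     : Decidable _≈_
    1≉0     : 1# ≉ 0#
    inverse : ∀ {x} → x ≉ 0# → ∃ λ y → x * y ≈ 1#

  open import Algebra.Definitions.RawSemiring (Semiring.rawSemiring semiring) public
    using (_^_; sum) renaming (_×_ to _·_)

  reciprocal : ∀ {x} → x ≉ 0# → Carrier
  reciprocal = proj₁ ∘ inverse

-- K is an algebraic closure of the prime field 𝔽_p: an element of such a K
-- is algebraic over 𝔽_p exactly when it lies in some 𝔽_{p^m}, i.e. when
-- x^(p^m) = x for some m ≥ 1.
record IsAlgebraicClosureOf𝔽 {κ ℓ} (p : ℕ) (K : DiscreteField κ ℓ) :
                             Set (κ ⊔ ℓ) where
  open DiscreteField K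
  field
    characteristic : p · 1# ≈ 0#
    algebraic      : ∀ x → ∃ λ m → x ^ (p ℕ.^ suc m) ≈ x
    closed         : ∀ {n} (a : Vector Carrier (suc n)) →
                     ∃ λ x → x ^ suc n + sum (λ i → a i * x ^ toℕ i) ≈ 0#

-- A solver for identities with integer coefficients in an arbitrary
-- commutative ring.
module IntegerSolver {κ ℓ} (R : CommutativeRing κ ℓ) where
  open CommutativeRing R
  open Algebra.Properties.Ring ring using (-‿distribˡ-*; -‿distribʳ-*; -0#≈0#)
  open Algebra.Properties.AbelianGroup +-abelianGroup
    using (⁻¹-involutive; ⁻¹-∙-comm)
  open Algebra.Properties.Semiring.Mult semiring
    using (×-homo-+; ×1-homo-*) renaming (_×_ to _·_)
  open Relation.Binary.Reasoning.Setoid setoid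

  ⟦_⟧ : ℤ → Carrier
  ⟦ + n ⟧      = n · 1#
  ⟦ -[1+ n ] ⟧ = - (suc n · 1#)

  neg-homo : ∀ i → ⟦ ℤ.- i ⟧ ≈ - ⟦ i ⟧
  neg-homo (+ zero)  = sym -0#≈0#
  neg-homo (+ suc n) = refl
  neg-homo -[1+ n ]  = sym (⁻¹-involutive _)

  ⊖-homo : ∀ m n → ⟦ m ℤ.⊖ n ⟧ ≈ m · 1# - n · 1#
  ⊖-homo m       zero    = begin
    m · 1#        ≈⟨ +-identityʳ _ ⟨
    m · 1# + 0#   ≈⟨ +-congˡ -0#≈0# ⟨
    m · 1# - 0#   ∎
  ⊖-homo zero    (suc n) = sym (+-identityˡ _)
  ⊖-homo (suc m) (suc n) = begin
    ⟦ suc m ℤ.⊖ suc n ⟧           ≡⟨ ≡.cong ⟦_⟧ (ℤ.[1+m]⊖[1+n]≡m⊖n m n) ⟩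
    ⟦ m ℤ.⊖ n ⟧                   ≈⟨ ⊖-homo m n ⟩
    a - b                         ≈⟨ +-congʳ (+-identityʳ a) ⟨
    (a + 0#) - b                  ≈⟨ +-congʳ (+-congˡ (-‿inverseʳ 1#)) ⟨
    (a + (1# - 1#)) - b           ≈⟨ +-congʳ (+-assoc a 1# (- 1#)) ⟨
    ((a + 1#) - 1#) - b           ≈⟨ +-assoc _ _ _ ⟩
    (a + 1#) + (- 1# - b)         ≈⟨ +-cong (+-comm a 1#) (⁻¹-∙-comm 1# b) ⟩
    (1# + a) - (1# + b)           ∎
    where
    a = m · 1#
    b = n · 1#

  +-homo : ∀ i j → ⟦ i ℤ.+ j ⟧ ≈ ⟦ i ⟧ + ⟦ j ⟧
  +-homo (+ m)    (+ n)    = ×-homo-+ 1# m n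
  +-homo (+ m)    -[1+ n ] = ⊖-homo m (suc n)
  +-homo -[1+ m ] (+ n)    = trans (⊖-homo n (suc m)) (+-comm _ _)
  +-homo -[1+ m ] -[1+ n ] = begin
    - (suc (suc (m ℕ.+ n)) · 1#)      ≡⟨ ≡.cong (λ k → - (k · 1#)) (ℕ.+-suc (suc m) n) ⟨
    - ((suc m ℕ.+ suc n) · 1#)        ≈⟨ -‿cong (×-homo-+ 1# (suc m) (suc n)) ⟩
    - (suc m · 1# + suc n · 1#)       ≈⟨ ⁻¹-∙-comm _ _ ⟨
    - (suc m · 1#) - (suc n · 1#)     ∎

  +◃-homo : ∀ n → ⟦ Sign.+ ℤ.◃ n ⟧ ≈ n · 1#
  +◃-homo zero    = refl
  +◃-homo (suc n) = refl

  -◃-homo : ∀ n → ⟦ Sign.- ℤ.◃ n ⟧ ≈ - (n · 1#)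
  -◃-homo zero    = sym -0#≈0#
  -◃-homo (suc n) = refl

  *-homo : ∀ i j → ⟦ i ℤ.* j ⟧ ≈ ⟦ i ⟧ * ⟦ j ⟧
  *-homo (+ m)    (+ n)    = trans (+◃-homo (m ℕ.* n)) (×1-homo-* m n)
  *-homo (+ m)    -[1+ n ] =
    trans (-◃-homo (m ℕ.* suc n))
      (trans (-‿cong (×1-homo-* m (suc n))) (-‿distribʳ-* _ _))
  *-homo -[1+ m ] (+ n)    =
    trans (-◃-homo (suc m ℕ.* n))
      (trans (-‿cong (×1-homo-* (suc m) n)) (-‿distribˡ-* _ _))
  *-homo -[1+ m ] -[1+ n ] = begin
    ⟦ Sign.+ ℤ.◃ suc m ℕ.* suc n ⟧      ≈⟨ +◃-homo (suc m ℕ.* suc n) ⟩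
    (suc m ℕ.* suc n) · 1#              ≈⟨ ×1-homo-* (suc m) (suc n) ⟩
    (suc m · 1#) * (suc n · 1#)         ≈⟨ ⁻¹-involutive _ ⟨
    - (- ((suc m · 1#) * (suc n · 1#))) ≈⟨ -‿cong (-‿distribˡ-* _ _) ⟩
    - (- (suc m · 1#) * (suc n · 1#))   ≈⟨ -‿distribʳ-* _ _ ⟩
    - (suc m · 1#) * - (suc n · 1#)     ∎

  morphism : ℤ.+-*-rawRing -Raw-AlmostCommutative⟶ fromCommutativeRing R
  morphism = record
    { ⟦_⟧    = ⟦_⟧
    ; +-homo = +-homo
    ; *-homo = *-homo
    ; -‿homo = neg-homo
    ; 0-homo = refl
    ; 1-homo = +-identityʳ 1#
    }

  coefficient≟ : WeaklyDecidable (λ i j → ⟦ i ⟧ ≈ ⟦ j ⟧)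
  coefficient≟ i j with i ℤ.≟ j
  ... | yes ≡.refl = just refl
  ... | no  _      = nothing

  open Algebra.Solver.Ring ℤ.+-*-rawRing (fromCommutativeRing R) morphism
    coefficient≟ public
    using (solve; _:=_; _:+_; _:*_; _:-_; :-_; _:^_; _:×_)

------------------------------------------------------------------------
-- Elliptic curves

record WeierstrassEquation {κ ℓ} (K : DiscreteField κ ℓ) : Set κ where
  open DiscreteField K
  field
    a₁ a₂ a₃ a₄ a₆ : Carrier

  b₂ b₄ b₆ b₈ Δ : Carrier
  b₂ = a₁ ^ 2 + 4 · a₂
  b₄ = 2 · a₄ + a₁ * a₃
  b₆ = a₃ ^ 2 + 4 · a₆
  b₈ = a₁ ^ 2 * a₆ + 4 · (a₂ * a₆) - a₁ * a₃ * a₄ + a₂ * a₃ ^ 2 - a₄ ^ 2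
  Δ  = - (b₂ ^ 2 * b₈) - 8 · b₄ ^ 3 - 27 · b₆ ^ 2 + 9 · (b₂ * b₄ * b₆)

  OnCurve : Carrier → Carrier → Set ℓ
  OnCurve x y = y ^ 2 + a₁ * x * y + a₃ * y ≈ x ^ 3 + a₂ * x ^ 2 + a₄ * x + a₆

record EllipticCurve {κ ℓ} (K : DiscreteField κ ℓ) : Set (κ ⊔ ℓ) where
  open DiscreteField K
  field
    weierstrassEquation : WeierstrassEquation K
  open WeierstrassEquation weierstrassEquation public
  field
    Δ≉0 : Δ ≉ 0#

------------------------------------------------------------------------
-- The group of points

module GroupLaw {κ ℓ} {K : DiscreteField κ ℓ} (E : EllipticCurve K) where
  open DiscreteField K
  open EllipticCurve E

  data Point : Set (κ ⊔ ℓ) where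
    O   : Point
    aff : (x y : Carrier) → OnCurve x y → Point

  infix 4 _≈ₚ_
  data _≈ₚ_ : Point → Point → Set (κ ⊔ ℓ) where
    O≈O     : O ≈ₚ O
    aff≈aff : ∀ {x y e x′ y′ e′} → x ≈ x′ → y ≈ y′ →
              aff x y e ≈ₚ aff x′ y′ e′

  private
    open module Solver = IntegerSolver commutativeRing using (solve; _:=_; _:+_; _:*_; _:-_; :-_; _:^_; _:×_)
  open Relation.Binary.Reasoning.Setoid setoid
  open Algebra.Properties.Group +-group
    using () renaming (x∙y⁻¹≈ε⇒x≈y to x-y≈0⇒x≈y; x≈y⇒x∙y⁻¹≈ε to x≈y⇒x-y≈0)
  open Algebra.Properties.Semiring.Exp semiring using (^-congˡ)

  third : (l x x′ : Carrier) → Carrier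
  third l x x′ = l ^ 2 + a₁ * l - a₂ - x - x′

  line : (l x y X : Carrier) → Carrier
  line l x y X = l * (X - x) + y

  conjugate : (x y : Carrier) → Carrier
  conjugate x y = - y - a₁ * x - a₃

  equation : Carrier → Carrier → Carrier
  equation x y = (y ^ 2 + a₁ * x * y + a₃ * y)
               - (x ^ 3 + a₂ * x ^ 2 + a₄ * x + a₆)

  -- Restricting the equation to the line of slope l through (x , y) gives
  -- minus a monic cubic in the abscissa.  This is the divided difference of
  -- that cubic at x and x′; if it vanishes and x is a root, then x, x′ and
  -- third l x x′ are the roots.
  divided : (l x y x′ : Carrier) → Carrier
  divided l x y x′ =
    (x ^ 2 + x * x′ + x′ ^ 2) + (a₂ - l ^ 2 - a₁ * l) * (x + x′)
    + (a₄ - 2 · (l * (y - l * x)) - a₁ * (y - l * x) - a₃ * l)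

  equation-third : ∀ l x y x′ →
    equation (third l x x′) (line l x y (third l x x′))
    ≈ equation x y - (third l x x′ - x) * divided l x y x′
  equation-third = solve 9
    (λ a₁ a₂ a₃ a₄ a₆ l x y x′ →
      let
        eqn = λ x y → (y :^ 2 :+ a₁ :* x :* y :+ a₃ :* y)
                   :- (x :^ 3 :+ a₂ :* x :^ 2 :+ a₄ :* x :+ a₆)
        X = l :^ 2 :+ a₁ :* l :- a₂ :- x :- x′
      in
      eqn X (l :* (X :- x) :+ y)
      := eqn x y :- (X :- x) :*
        ((x :^ 2 :+ x :* x′ :+ x′ :^ 2) :+ (a₂ :- l :^ 2 :- a₁ :* l) :* (x :+ x′)
        :+ (a₄ :- 2 :× (l :* (y :- l :* x)) :- a₁ :* (y :- l :* x) :- a₃ :* l)))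
    refl a₁ a₂ a₃ a₄ a₆

  equation-conjugate : ∀ x y → equation x (conjugate x y) ≈ equation x y
  equation-conjugate = solve 7
    (λ a₁ a₂ a₃ a₄ a₆ x y →
      let
        eqn = λ x y → (y :^ 2 :+ a₁ :* x :* y :+ a₃ :* y)
                   :- (x :^ 3 :+ a₂ :* x :^ 2 :+ a₄ :* x :+ a₆)
      in
      eqn x (:- y :- a₁ :* x :- a₃) := eqn x y)
    refl a₁ a₂ a₃ a₄ a₆

  divided-chord : ∀ l x y x′ →
    divided l x y x′ * (x′ - x) ≈ equation x y - equation x′ (line l x y x′)
  divided-chord = solve 9
    (λ a₁ a₂ a₃ a₄ a₆ l x y x′ →
      let
        eqn = λ x y → (y :^ 2 :+ a₁ :* x :* y :+ a₃ :* y)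
                   :- (x :^ 3 :+ a₂ :* x :^ 2 :+ a₄ :* x :+ a₆)
      in
      ((x :^ 2 :+ x :* x′ :+ x′ :^ 2) :+ (a₂ :- l :^ 2 :- a₁ :* l) :* (x :+ x′)
        :+ (a₄ :- 2 :× (l :* (y :- l :* x)) :- a₁ :* (y :- l :* x) :- a₃ :* l))
        :* (x′ :- x)
      := eqn x y :- eqn x′ (l :* (x′ :- x) :+ y))
    refl a₁ a₂ a₃ a₄ a₆

  tangentNumerator tangentDenominator : (x y : Carrier) → Carrier
  tangentNumerator   x y = 3 · x ^ 2 + 2 · (a₂ * x) + a₄ - a₁ * y
  tangentDenominator x y = 2 · y + a₁ * x + a₃

  divided-tangent : ∀ l x y →
    divided l x y x ≈ tangentNumerator x y - l * tangentDenominator x y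
  divided-tangent = solve 8
    (λ a₁ a₂ a₃ a₄ a₆ l x y →
      (x :^ 2 :+ x :* x :+ x :^ 2) :+ (a₂ :- l :^ 2 :- a₁ :* l) :* (x :+ x)
        :+ (a₄ :- 2 :× (l :* (y :- l :* x)) :- a₁ :* (y :- l :* x) :- a₃ :* l)
      := (3 :× x :^ 2 :+ 2 :× (a₂ :* x) :+ a₄ :- a₁ :* y)
        :- l :* (2 :× y :+ a₁ :* x :+ a₃))
    refl a₁ a₂ a₃ a₄ a₆

  equation-congʳ : ∀ x {y y′} → y ≈ y′ → equation x y ≈ equation x y′
  equation-congʳ x y≈y′ =
    +-congʳ (+-cong (+-cong (^-congˡ 2 y≈y′) (*-congˡ y≈y′)) (*-congˡ y≈y′))

  slope : (n : Carrier) {d : Carrier} → d ≉ 0# → Carrier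
  slope n d≉0 = n * reciprocal d≉0

  slope-* : ∀ n {d} (d≉0 : d ≉ 0#) → slope n d≉0 * d ≈ n
  slope-* n {d} d≉0 = begin
    n * reciprocal d≉0 * d     ≈⟨ *-assoc _ _ _ ⟩
    n * (reciprocal d≉0 * d)   ≈⟨ *-congˡ (*-comm _ _) ⟩
    n * (d * reciprocal d≉0)   ≈⟨ *-congˡ (proj₂ (inverse d≉0)) ⟩
    n * 1#                     ≈⟨ *-identityʳ n ⟩
    n                          ∎

  cancel : ∀ {z d} → d ≉ 0# → z * d ≈ 0# → z ≈ 0#
  cancel {z} {d} d≉0 zd≈0 = begin
    z                        ≈⟨ *-identityʳ z ⟨
    z * 1#                   ≈⟨ *-congˡ (proj₂ (inverse d≉0)) ⟨
    z * (d * reciprocal d≉0) ≈⟨ *-assoc _ _ _ ⟨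
    z * d * reciprocal d≉0   ≈⟨ *-congʳ zd≈0 ⟩
    0# * reciprocal d≉0      ≈⟨ zeroˡ _ ⟩
    0#                       ∎

  chord-divided : ∀ {x y x′ y′} → OnCurve x y → OnCurve x′ y′ →
                  (x′-x≉0 : x′ - x ≉ 0#) →
                  divided (slope (y′ - y) x′-x≉0) x y x′ ≈ 0#
  chord-divided {x} {y} {x′} {y′} e e′ x′-x≉0 = cancel x′-x≉0 (begin
    divided l x y x′ * (x′ - x)                      ≈⟨ divided-chord l x y x′ ⟩
    equation x y - equation x′ (line l x y x′)       ≈⟨ +-congˡ (-‿cong (equation-congʳ x′ through)) ⟩
    equation x y - equation x′ y′                    ≈⟨ +-cong (x≈y⇒x-y≈0 e) (-‿cong (x≈y⇒x-y≈0 e′)) ⟩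
    0# - 0#                                          ≈⟨ -‿inverseʳ 0# ⟩
    0#                                               ∎)
    where
    l = slope (y′ - y) x′-x≉0

    through : line l x y x′ ≈ y′
    through = begin
      l * (x′ - x) + y   ≈⟨ +-congʳ (slope-* (y′ - y) x′-x≉0) ⟩
      y′ - y + y         ≈⟨ +-assoc _ _ _ ⟩
      y′ + (- y + y)     ≈⟨ +-congˡ (-‿inverseˡ y) ⟩
      y′ + 0#            ≈⟨ +-identityʳ y′ ⟩
      y′                 ∎

  tangent-divided : ∀ x y (d≉0 : tangentDenominator x y ≉ 0#) →
                    divided (slope (tangentNumerator x y) d≉0) x y x ≈ 0#
  tangent-divided x y d≉0 =
    trans (divided-tangent _ x y) (x≈y⇒x-y≈0 (sym (slope-* _ d≉0)))

  opposite : Point → Point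
  opposite O           = O
  opposite (aff x y e) = aff x (conjugate x y)
    (x-y≈0⇒x≈y _ _ (trans (equation-conjugate x y) (x≈y⇒x-y≈0 e)))

  thirdPoint : ∀ l x y x′ → OnCurve x y → divided l x y x′ ≈ 0# → Point
  thirdPoint l x y x′ e d≈0 = aff X (line l x y X) (x-y≈0⇒x≈y _ _ (begin
    equation X (line l x y X)                       ≈⟨ equation-third l x y x′ ⟩
    equation x y - (X - x) * divided l x y x′       ≈⟨ +-cong (x≈y⇒x-y≈0 e) (-‿cong (trans (*-congˡ d≈0) (zeroʳ _))) ⟩
    0# - 0#                                         ≈⟨ -‿inverseʳ 0# ⟩
    0#                                              ∎))
    where
    X = third l x x′

  -- For equal abscissas, either the ordinates differ, so that the points are
  -- opposite, or the points agree, and then they are opposite exactly when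
  -- the denominator of the tangent slope vanishes.
  infixl 6 _⊕_
  _⊕_ : Point → Point → Point
  O           ⊕ Q             = Q
  P@(aff _ _ _) ⊕ O           = P
  aff x y e   ⊕ aff x′ y′ e′ with (x′ - x) ≟ 0# | (y′ - y) ≟ 0# | tangentDenominator x y ≟ 0#
  ... | no x′-x≉0 | _     | _       =
    opposite (thirdPoint (slope (y′ - y) x′-x≉0) x y x′ e (chord-divided e e′ x′-x≉0))
  ... | yes _     | no _  | _       = O
  ... | yes _     | yes _ | yes _   = O
  ... | yes _     | yes _ | no d≉0  =
    opposite (thirdPoint (slope (tangentNumerator x y) d≉0) x y x e (tangent-divided x y d≉0))

  ⊕-rawMonoid : RawMonoid (κ ⊔ ℓ) (κ ⊔ ℓ)
  ⊕-rawMonoid = record { _≈_ = _≈ₚ_ ; _∙_ = _⊕_ ; ε = O }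

  open Algebra.Definitions.RawMonoid ⊕-rawMonoid public
    using () renaming (_×_ to _·ₚ_)

------------------------------------------------------------------------
-- Endomorphisms

module Endomorphisms {κ ℓ} {K : DiscreteField κ ℓ} (E : EllipticCurve K) where
  open DiscreteField K
  open GroupLaw E

  record Monomial (d : ℕ) : Set κ where
    field
      coefficient : Carrier
      i j k       : ℕ
      degree      : i ℕ.+ j ℕ.+ k ≡ d

  Form : ℕ → Set κ
  Form d = List (Monomial d)

  eval : ∀ {d} → Form d → Vector Carrier 3 → Carrier
  eval []      v = 0#
  eval (m ∷ f) v =
    coefficient * (v 0F ^ i * v 1F ^ j * v 2F ^ k)
    + eval f v
    where open Monomial m

  homogeneous : Point → Vector Carrier 3
  homogeneous O           0F = 0#
  homogeneous O           1F = 1#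
  homogeneous O           2F = 0#
  homogeneous (aff x y _) 0F = x
  homogeneous (aff x y _) 1F = y
  homogeneous (aff x y _) 2F = 1#

  -- [ F₀ (Q) : F₁ (Q) : F₂ (Q) ] is a point of the projective plane.
  DefinedAt : ∀ {d} → (Fin 3 → Form d) → Point → Set ℓ
  DefinedAt F Q = ¬ (∀ r → eval (F r) (homogeneous Q) ≈ 0#)

  -- φ is a morphism of projective curves: near every point it is given by
  -- homogeneous polynomials of a common degree without a common zero there.
  IsMorphism : (Point → Point) → Set (κ ⊔ ℓ)
  IsMorphism φ = ∀ P → ∃ λ d → Σ (Fin 3 → Form d) λ F →
    DefinedAt F P ×
    (∀ Q → DefinedAt F Q → ∃ λ t → ∀ r →
      eval (F r) (homogeneous Q) ≈ t * homogeneous (φ Q) r)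

  -- A morphism fixing O is automatically a group homomorphism.
  record IsEndomorphism (φ : Point → Point) : Set (κ ⊔ ℓ) where
    field
      cong       : ∀ {P Q} → P ≈ₚ Q → φ P ≈ₚ φ Q
      isMorphism : IsMorphism φ
      fixes-O    : φ O ≈ₚ O

  -- The operations of End(E), on all self-maps of E(K): pointwise addition
  -- and composition.  (Not itself a ring: composing with an arbitrary map on the
  -- left is not additive.  End(E) is the part cut out by IsEndomorphism.)
  selfMaps : RawRing (κ ⊔ ℓ) (κ ⊔ ℓ)
  selfMaps = record
    { Carrier = Point → Point
    ; _≈_     = λ φ ψ → ∀ P → φ P ≈ₚ ψ P
    ; _+_     = λ φ ψ P → φ P ⊕ ψ P
    ; _*_     = λ φ ψ P → φ (ψ P)
    ; -_      = λ φ P → opposite (φ P)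
    ; 0#      = λ _ → O
    ; 1#      = λ P → P
    }

module _ {κ ℓ} {K : DiscreteField κ ℓ} where
  open DiscreteField K

  IsDefinedOver𝔽 : ℕ → EllipticCurve K → Set ℓ
  IsDefinedOver𝔽 q E =
    a₁ ^ q ≈ a₁ × a₂ ^ q ≈ a₂ × a₃ ^ q ≈ a₃ × a₄ ^ q ≈ a₄ × a₆ ^ q ≈ a₆
    where open EllipticCurve E

  -- No nontrivial p-torsion over the algebraically closed field K of
  -- characteristic p.
  IsSupersingular : ℕ → EllipticCurve K → Set (κ ⊔ ℓ)
  IsSupersingular p E = ∀ P → p ·ₚ P ≈ₚ O → P ≈ₚ O
    where open GroupLaw E

  -- An injective ring homomorphism R → End(E).
  record RingEmbedding {a b} (R : RawRing a b) (E : EllipticCurve K) :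
                     Set (κ ⊔ ℓ ⊔ a ⊔ b) where
    open Endomorphisms E
    open RingMorphisms R selfMaps
    field
      embedding          : RawRing.Carrier R → RawRing.Carrier selfMaps
      isEndomorphism     : ∀ r → IsEndomorphism (embedding r)
      isRingMonomorphism : IsRingMonomorphism embedding

  -- A ring isomorphism R ≅ End(E).
  record EndomorphismRing≅ {a b} (E : EllipticCurve K) (R : RawRing a b) :
                           Set (κ ⊔ ℓ ⊔ a ⊔ b) where
    open Endomorphisms E
    field
      ringEmbedding : RingEmbedding R E
    open RingEmbedding ringEmbedding public
    field
      surjective : ∀ φ → IsEndomorphism φ →
                   ∃ λ r → RawRing._≈_ selfMaps (embedding r) φ

  IsOriented : ∀ {a b} → RawRing a b → EllipticCurve K → Set (κ ⊔ ℓ ⊔ a ⊔ b)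
  IsOriented = RingEmbedding

------------------------------------------------------------------------
-- Imaginary quadratic orders

-- ℤ[θ] with θ² = τθ - ν; the pair (x , y) stands for x + yθ.
quadraticOrder : (τ ν : ℤ) → RawRing 0ℓ 0ℓ
quadraticOrder τ ν = record
  { Carrier = ℤ × ℤ
  ; _≈_     = _≡_
  ; _+_     = λ (x , y) (x′ , y′) → x ℤ.+ x′ , y ℤ.+ y′
  ; _*_     = λ (x , y) (x′ , y′) →
                x ℤ.* x′ ℤ.- ν ℤ.* (y ℤ.* y′) ,
                x ℤ.* y′ ℤ.+ y ℤ.* x′ ℤ.+ τ ℤ.* (y ℤ.* y′)
  ; -_      = λ (x , y) → ℤ.- x , ℤ.- y
  ; 0#      = ℤ.0ℤ , ℤ.0ℤ
  ; 1#      = ℤ.1ℤ , ℤ.0ℤ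
  }

ℤ[√-_] : ℕ → RawRing 0ℓ 0ℓ
ℤ[√- m ] = quadraticOrder ℤ.0ℤ (+ m)

-- (1 + √-m)/2 has trace 1 and norm (1 + m)/4; it generates an order exactly
-- when it is integral, i.e. when 4 divides 1 + m.
ℤ[1+√-_/2] : (m : ℕ) → 4 ∣ 1 ℕ.+ m → RawRing 0ℓ 0ℓ
ℤ[1+√- m /2] 4∣1+m = quadraticOrder ℤ.1ℤ (+ quotient 4∣1+m)

------------------------------------------------------------------------
-- Ternary quadratic forms

record TernaryForm : Set where
  field
    a b c u v w : ℤ

module _ (F : TernaryForm) where
  open TernaryForm F
  open import Data.Integer.Base using (_+_; _*_; _-_; -_; 0ℤ; 1ℤ)

  value : ℤ → ℤ → ℤ → ℤ
  value x y z =
    + 2 * a * (x * x) + + 2 * b * (y * y) + + 2 * c * (z * z)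
    + + 2 * u * (y * z) + + 2 * v * (x * z) + + 2 * w * (x * y)

  discriminant : ℤ
  discriminant =
    + 4 * (a * b * c) + u * v * w - a * (u * u) - b * (v * v) - c * (w * w)

  ProperlyRepresents : ℤ → Set
  ProperlyRepresents n = ∃ λ x → ∃ λ y → ∃ λ z →
    ℤ.gcd (ℤ.gcd x y) z ≡ 1ℤ × value x y z ≡ n

  -- Clf⁰(F); the tuple (t , x , y , z) stands for t + xi + yj + zk.  Besides
  --   ii = ui - bc     jj = vj - ac     kk = wk - ab
  --   jk = a(u - i)    ki = b(v - j)    ij = c(w - k)
  -- the product uses the relations forced by associativity:
  --   kj = ai + wj + vk - vw
  --   ik = wi + bj + uk - uw
  --   ji = vi + uj + ck - uv
  Clf⁰ : RawRing 0ℓ 0ℓ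
  Clf⁰ = record
    { Carrier = ℤ × ℤ × ℤ × ℤ
    ; _≈_     = _≡_
    ; _+_     = λ (t , x , y , z) (t′ , x′ , y′ , z′) →
                  t + t′ , x + x′ , y + y′ , z + z′
    ; _*_     = λ (t , x , y , z) (t′ , x′ , y′ , z′) →
          t * t′
            - b * c * (x * x′) - a * c * (y * y′) - a * b * (z * z′)
            + a * u * (y * z′) - v * w * (z * y′)
            + b * v * (z * x′) - u * w * (x * z′)
            + c * w * (x * y′) - u * v * (y * x′)
        , t * x′ + x * t′ + u * (x * x′)
            - a * (y * z′) + a * (z * y′) + w * (x * z′) + v * (y * x′)
        , t * y′ + y * t′ + v * (y * y′)
            - b * (z * x′) + b * (x * z′) + w * (z * y′) + u * (y * x′)
        , t * z′ + z * t′ + w * (z * z′)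
            - c * (x * y′) + c * (y * x′) + v * (z * y′) + u * (x * z′)
    ; -_      = λ (t , x , y , z) → - t , - x , - y , - z
    ; 0#      = 0ℤ , 0ℤ , 0ℤ , 0ℤ
    ; 1#      = 1ℤ , 0ℤ , 0ℤ , 0ℤ
    }

{-# OPTIONS --safe #-}

-- Since End(E) ≅ Clf⁰(F), either orientation amounts to an element of Clf⁰(F)
-- with square -cp: given θ = (1 + √-cp)/2, take 2θ - 1.
-- Let M be the Gram matrix of F, so that det M = 2p, and let A be its adjugate.
-- An element t + xi + yj + zk of Clf⁰(F) with square -cp has trace zero, so
-- that it is determined by X = (x , y , z), and ᵗX A X = 4cp.  The claim is that
-- v ↦ M v and X ↦ A X / 2p are inverse bijections between the solutions of
-- F(v) = 2c and these X.  The point is that A X is divisible by 2p.  Modulo p,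
-- the 2 × 2 minors of A vanish, so (A X)ᵢ² ≡ Aᵢᵢ (ᵗX A X) ≡ 0; modulo 2, the
-- vector A X is the multiple of (u , v , w) by the trace, which is zero.  Finally,
-- every solution v is primitive, because F is even and 2c is twice a prime.

module Submission where

open import Defs
open import Algebra.Bundles using (AbelianGroup; RawRing)
import Algebra.Definitions.RawMonoid
import Algebra.Morphism.Construct.Composition as Composition
open import Algebra.Morphism.Structures using (module RingMorphisms)
import Algebra.Properties.Group
import Algebra.Properties.Monoid.Mult
import Algebra.Properties.Semiring.Exp
open import Data.Integer.Base as ℤ using (ℤ; +_; -[1+_]; 0ℤ; 1ℤ; ∣_∣)
open import Data.Integer.Divisibility.Signed as ℤ using (divides)
import Data.Integer.GCD as ℤ
import Data.Integer.Properties as ℤ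
open import Data.Integer.Solver using (module +-*-Solver)
open import Data.Nat.Base as ℕ using (ℕ; zero; suc; NonZero)
open import Data.Nat.Coprimality using (coprime-divisor; prime⇒coprime)
open import Data.Nat.Divisibility using (_∣_; quotient)
import Data.Nat.Divisibility as ℕ
import Data.Nat.GCD as ℕ
open import Data.Nat.Primality
  using (Prime; euclidsLemma; prime⇒irreducible; prime⇒nonZero)
import Data.Nat.Properties as ℕ
open import Data.Product.Base using (Σ; ∃; _×_; _,_; proj₁; proj₂)
open import Data.Sum.Base using (_⊎_; inj₁; inj₂; [_,_]′)
open import Function.Base using (_∘_; id)
open import Function.Bundles using (_⇔_; mk⇔)
open import Relation.Binary.PropositionalEquality.Core as ≡
  using (_≡_; _≢_; cong; cong₂)
import Relation.Binary.PropositionalEquality.Properties as ≡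
import Relation.Binary.Reasoning.Setoid
open import Relation.Nullary using (¬_; yes; no; contradiction)

-- Congruence of the group law

module _ {κ ℓ} {K : DiscreteField κ ℓ} (E : EllipticCurve K) where
  open DiscreteField K
  open GroupLaw E
  open Algebra.Properties.Semiring.Exp semiring using (^-congˡ)
  open Algebra.Properties.Monoid.Mult +-monoid using (×-congʳ)

  ≈ₚ-sym : ∀ {P Q} → P ≈ₚ Q → Q ≈ₚ P
  ≈ₚ-sym O≈O           = O≈O
  ≈ₚ-sym (aff≈aff p q) = aff≈aff (sym p) (sym q)

  ≈ₚ-trans : ∀ {P Q R} → P ≈ₚ Q → Q ≈ₚ R → P ≈ₚ R
  ≈ₚ-trans O≈O           O≈O             = O≈O
  ≈ₚ-trans (aff≈aff p q) (aff≈aff p′ q′) = aff≈aff (trans p p′) (trans q q′)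

  -‿cong₂ : ∀ {x x′ y y′} → x ≈ x′ → y ≈ y′ → x - y ≈ x′ - y′
  -‿cong₂ p q = +-cong p (-‿cong q)

  -- `inverse` is given with a proof of `d ≉ 0#` and carries no congruence law; uniqueness of
  -- inverses in a commutative ring supplies one.
  reciprocal-cong : ∀ {d d′} (d≉0 : d ≉ 0#) (d′≉0 : d′ ≉ 0#) → d ≈ d′ →
                    reciprocal d≉0 ≈ reciprocal d′≉0
  reciprocal-cong {d} {d′} d≉0 d′≉0 d≈d′ = begin
    r               ≈⟨ *-identityʳ r ⟨
    r * 1#          ≈⟨ *-congˡ (proj₂ (inverse d′≉0)) ⟨
    r * (d′ * r′)   ≈⟨ *-assoc _ _ _ ⟨
    (r * d′) * r′   ≈⟨ *-congʳ (*-congˡ d≈d′) ⟨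
    (r * d) * r′    ≈⟨ *-congʳ (trans (*-comm _ _) (proj₂ (inverse d≉0))) ⟩
    1# * r′         ≈⟨ *-identityˡ r′ ⟩
    r′              ∎
    where
    open Relation.Binary.Reasoning.Setoid setoid
    r  = reciprocal d≉0
    r′ = reciprocal d′≉0

  slope-cong : ∀ {n n′ d d′} (d≉0 : d ≉ 0#) (d′≉0 : d′ ≉ 0#) →
               n ≈ n′ → d ≈ d′ → slope n d≉0 ≈ slope n′ d′≉0
  slope-cong d≉0 d′≉0 p q = *-cong p (reciprocal-cong d≉0 d′≉0 q)

  conjugate-cong : ∀ {x x′ y y′} → x ≈ x′ → y ≈ y′ →
                   conjugate x y ≈ conjugate x′ y′
  conjugate-cong p q = +-congʳ (-‿cong₂ (-‿cong q) (*-congˡ p))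

  opposite-cong : ∀ {P Q} → P ≈ₚ Q → opposite P ≈ₚ opposite Q
  opposite-cong O≈O           = O≈O
  opposite-cong (aff≈aff p q) = aff≈aff p (conjugate-cong p q)

  thirdPoint-cong :
    ∀ {l l′ x₁ x₁′ y₁ y₁′ x₂ x₂′ e e′ d≈0 d′≈0} →
    l ≈ l′ → x₁ ≈ x₁′ → y₁ ≈ y₁′ → x₂ ≈ x₂′ →
    thirdPoint l x₁ y₁ x₂ e d≈0 ≈ₚ thirdPoint l′ x₁′ y₁′ x₂′ e′ d′≈0
  thirdPoint-cong p q r s = aff≈aff third≈ (+-cong (*-cong p (-‿cong₂ third≈ q)) r)
    where third≈ = -‿cong₂ (-‿cong₂ (+-congʳ (+-cong (^-congˡ 2 p) (*-congˡ p))) q) s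

  tangentNumerator-cong : ∀ {x x′ y y′} → x ≈ x′ → y ≈ y′ →
                          tangentNumerator x y ≈ tangentNumerator x′ y′
  tangentNumerator-cong p q =
    -‿cong₂ (+-congʳ (+-cong (×-congʳ 3 (^-congˡ 2 p)) (×-congʳ 2 (*-congˡ p)))) (*-congˡ q)

  tangentDenominator-cong : ∀ {x x′ y y′} → x ≈ x′ → y ≈ y′ →
                            tangentDenominator x y ≈ tangentDenominator x′ y′
  tangentDenominator-cong p q = +-congʳ (+-cong (×-congʳ 2 q) (*-congˡ p))

  -- `_⊕_` branches on three decided equations. All are decided on both sides at once: outcomes that
  -- disagree contradict the congruence of the tested differences and denominators, and outcomes
  -- that agree select the same formula.
  ⊕-cong : ∀ {P P′ Q Q′} → P ≈ₚ P′ → Q ≈ₚ Q′ → P ⊕ Q ≈ₚ P′ ⊕ Q′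
  ⊕-cong O≈O                Q≈Q′ = Q≈Q′
  ⊕-cong P≈P′@(aff≈aff _ _) O≈O  = P≈P′
  ⊕-cong (aff≈aff {x₁} {y₁} {_} {x₁′} {y₁′} x₁≈ y₁≈)
         (aff≈aff {x₂} {y₂} {_} {x₂′} {y₂′} x₂≈ y₂≈)
    with -‿cong₂ x₂≈ x₁≈ | -‿cong₂ y₂≈ y₁≈ | tangentDenominator-cong x₁≈ y₁≈
       | (x₂ - x₁) ≟ 0# | (x₂′ - x₁′) ≟ 0#
       | (y₂ - y₁) ≟ 0# | (y₂′ - y₁′) ≟ 0#
       | tangentDenominator x₁ y₁ ≟ 0# | tangentDenominator x₁′ y₁′ ≟ 0#
  ... | p | q | _ | no d≉0 | no d′≉0 | _ | _ | _ | _ =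
    opposite-cong (thirdPoint-cong (slope-cong d≉0 d′≉0 q p) x₁≈ y₁≈ x₂≈)
  ... | p | _ | _ | no d≉0 | yes d≈0 | _ | _ | _ | _ = contradiction (trans p d≈0) d≉0
  ... | p | _ | _ | yes d≈0 | no d≉0 | _ | _ | _ | _ = contradiction (trans (sym p) d≈0) d≉0
  ... | _ | _ | _ | yes _ | yes _ | no _ | no _ | _ | _ = O≈O
  ... | _ | q | _ | yes _ | yes _ | no d≉0 | yes d≈0 | _ | _ = contradiction (trans q d≈0) d≉0
  ... | _ | q | _ | yes _ | yes _ | yes d≈0 | no d≉0 | _ | _ = contradiction (trans (sym q) d≈0) d≉0
  ... | _ | _ | _ | yes _ | yes _ | yes _ | yes _ | yes _ | yes _ = O≈O
  ... | _ | _ | r | yes _ | yes _ | yes _ | yes _ | no d≉0 | yes d≈0 = contradiction (trans r d≈0) d≉0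
  ... | _ | _ | r | yes _ | yes _ | yes _ | yes _ | yes d≈0 | no d≉0 = contradiction (trans (sym r) d≈0) d≉0
  ... | _ | _ | r | yes _ | yes _ | yes _ | yes _ | no d≉0 | no d′≉0 =
    opposite-cong (thirdPoint-cong
      (slope-cong d≉0 d′≉0 (tangentNumerator-cong x₁≈ y₁≈) r) x₁≈ y₁≈ x₁≈)

-- Ring embeddings into endomorphism rings

  module _ {a b} (R : RawRing a b) where
    open RawRing R using () renaming (-_ to -ᴿ_; 1# to 1ᴿ; +-rawMonoid to +ᴿ-rawMonoid)
    open Algebra.Definitions.RawMonoid +ᴿ-rawMonoid using () renaming (_×_ to _·ᴿ_)

    module _ (f : RingEmbedding R E) where
      open RingEmbedding f
      open RingMorphisms.IsRingMonomorphism isRingMonomorphism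

      -- Whatever the source ring, an integer acts on points as the corresponding multiple. This
      -- allows -n to be compared across embeddings of two different rings into End(E).
      embedding-multiple : ∀ n P → embedding (n ·ᴿ 1ᴿ) P ≈ₚ n ·ₚ P
      embedding-multiple zero    P = 0#-homo P
      embedding-multiple (suc n) P =
        ≈ₚ-trans (+-homo _ _ P) (⊕-cong (1#-homo P) (embedding-multiple n P))

      embedding-negMultiple : ∀ n P → embedding (-ᴿ (n ·ᴿ 1ᴿ)) P ≈ₚ opposite (n ·ₚ P)
      embedding-negMultiple n P =
        ≈ₚ-trans (-‿homo _ P) (opposite-cong (embedding-multiple n P))

  precompose : ∀ {a b a′ b′} {R : RawRing a b} {S : RawRing a′ b′}
               (h : RawRing.Carrier R → RawRing.Carrier S) →
               RingMorphisms.IsRingMonomorphism R S h →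
               RingEmbedding S E → RingEmbedding R E
  precompose h hMono f = record
    { embedding          = embedding ∘ h
    ; isEndomorphism     = isEndomorphism ∘ h
    ; isRingMonomorphism =
        Composition.isRingMonomorphism (λ p q P → ≈ₚ-trans (p P) (q P)) hMono isRingMonomorphism
    }
    where open RingEmbedding f

open +-*-Solver using (Polynomial; solve; con; _:+_; _:*_; _:-_; :-_; _:=_)

-- Integer arithmetic

module _ where
  open import Data.Integer.Base using (_*_; _-_)

  square≢- : ∀ t n .{{_ : NonZero n}} → t * t ≢ ℤ.- + n
  square≢- (+ zero)    (suc n) ()
  square≢- (+ suc t)   (suc n) ()
  square≢- -[1+ t ]    (suc n) ()

  -- Used on products in Clf⁰(F), where `s` and `s′` are corresponding components of α² and -n.
  drop-vanishing : ∀ {i j : ℤ} k {s s′} → i ≡ j ℤ.+ k * (s - s′) → s ≡ s′ → i ≡ j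
  drop-vanishing {i} {j} k {s} i≡ ≡.refl = begin
    i                    ≡⟨ i≡ ⟩
    j ℤ.+ k * (s - s)    ≡⟨ cong (λ d → j ℤ.+ k * d) (ℤ.+-inverseʳ s) ⟩
    j ℤ.+ k * 0ℤ         ≡⟨ cong (λ d → j ℤ.+ d) (ℤ.*-zeroʳ k) ⟩
    j ℤ.+ 0ℤ             ≡⟨ ℤ.+-identityʳ j ⟩
    j                    ∎
    where open ≡.≡-Reasoning

  module _ {p} (p-prime : Prime p) where

    prime∣square : ∀ i → + p ℤ.∣ i * i → + p ℤ.∣ i
    prime∣square i p∣i² = ℤ.∣ᵤ⇒∣ {+ p} {i} ([ id , id ]′ (euclidsLemma ∣ i ∣ ∣ i ∣ p-prime
      (≡.subst (p ∣_) (ℤ.abs-* i i) (ℤ.∣⇒∣ᵤ {+ p} {i * i} p∣i²))))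

    -- An odd prime p is coprime to 2, so if p divides i = 2q, then it divides q.
    2p∣ : 2 ℕ.< p → ∀ i → + p ℤ.∣ i → + 2 ℤ.∣ i → ∃ λ k → i ≡ k * (+ 2 * + p)
    2p∣ 2<p i p∣i (divides q ≡.refl)
      with ℤ.∣ᵤ⇒∣ {+ p} {q} (coprime-divisor {p} {2} {∣ q ∣} (prime⇒coprime p-prime 2<p)
        (≡.subst (p ∣_) (≡.trans (ℤ.abs-* q (+ 2)) (ℕ.*-comm ∣ q ∣ 2)) (ℤ.∣⇒∣ᵤ {+ p} {i} p∣i)))
    ... | divides k ≡.refl =
      k , solve 2 (λ k p → k :* p :* con (+ 2) := k :* (con (+ 2) :* p)) ≡.refl k (+ p)

    -- Write i = 2j. Halving gives p = g·h·g with h = |j|, so g is 1 or p. The evenness of i matters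
    -- for p = 2, where otherwise g = 2 and i = 1 would be a solution.
    square∣twice-prime : ∀ g {i} → + 2 ℤ.∣ i → + g * + g * i ≡ + (2 ℕ.* p) → g ≡ 1
    square∣twice-prime g {i} (divides j i≡2j) g²i≡2p =
      [ id , g≡p⇒g≡1 ]′ (prime⇒irreducible p-prime (ℕ.divides (g ℕ.* h) p≡))
      where
      open ≡.≡-Reasoning
      h = ∣ j ∣

      p≡ : p ≡ g ℕ.* h ℕ.* g
      p≡ = ℕ.*-cancelʳ-≡ p (g ℕ.* h ℕ.* g) 2 (begin
        p ℕ.* 2                         ≡⟨ ℕ.*-comm p 2 ⟩
        2 ℕ.* p                         ≡⟨ cong ∣_∣ g²i≡2p ⟨
        ∣ + g * + g * i ∣               ≡⟨ cong (λ i → ∣ + g * + g * i ∣) i≡2j ⟩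
        ∣ + g * + g * (j * + 2) ∣       ≡⟨ ℤ.abs-* (+ g * + g) (j * + 2) ⟩
        ∣ + g * + g ∣ ℕ.* ∣ j * + 2 ∣   ≡⟨ cong₂ ℕ._*_ (ℤ.abs-* (+ g) (+ g)) (ℤ.abs-* j (+ 2)) ⟩
        g ℕ.* g ℕ.* (h ℕ.* 2)           ≡⟨ ℕ.*-assoc (g ℕ.* g) h 2 ⟨
        g ℕ.* g ℕ.* h ℕ.* 2             ≡⟨ cong (ℕ._* 2) (ℕ.*-assoc g g h) ⟩
        g ℕ.* (g ℕ.* h) ℕ.* 2           ≡⟨ cong (ℕ._* 2) (ℕ.*-comm g (g ℕ.* h)) ⟩
        g ℕ.* h ℕ.* g ℕ.* 2             ∎)

      -- Now p = g·h·p, and cancelling p leaves g·h = 1.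
      g≡p⇒g≡1 : g ≡ p → g ≡ 1
      g≡p⇒g≡1 g≡p = ℕ.m*n≡1⇒m≡1 g h
        (ℕ.*-cancelʳ-≡ (g ℕ.* h) 1 p {{prime⇒nonZero p-prime}} (begin
          g ℕ.* h ℕ.* p    ≡⟨ cong (λ m → g ℕ.* h ℕ.* m) g≡p ⟨
          g ℕ.* h ℕ.* g    ≡⟨ p≡ ⟨
          p                ≡⟨ ℕ.*-identityˡ p ⟨
          1 ℕ.* p          ∎))

-- Identities for the Gram matrix, its adjugate and Clf⁰

module _ {n} (a b c u v w : Polynomial n) where

  -- This and the definitions up to `product₃` reify, for the ring solver, the integer expressions
  -- of the same shape, so that the identities below can share them.
  discriminantᴾ : Polynomial n
  discriminantᴾ =
    con (+ 4) :* (a :* b :* c) :+ u :* v :* w :- a :* (u :* u) :- b :* (v :* v) :- c :* (w :* w)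

  valueᴾ : (x y z : Polynomial n) → Polynomial n
  valueᴾ x y z =
    con (+ 2) :* a :* (x :* x) :+ con (+ 2) :* b :* (y :* y) :+ con (+ 2) :* c :* (z :* z)
    :+ con (+ 2) :* u :* (y :* z) :+ con (+ 2) :* v :* (x :* z) :+ con (+ 2) :* w :* (x :* y)

  adj₁ᴾ adj₂ᴾ adj₃ᴾ adjValueᴾ : (x y z : Polynomial n) → Polynomial n
  adj₁ᴾ x y z = (con (+ 4) :* (b :* c) :- u :* u) :* x
    :+ (u :* v :- con (+ 2) :* (c :* w)) :* y :+ (u :* w :- con (+ 2) :* (b :* v)) :* z
  adj₂ᴾ x y z = (u :* v :- con (+ 2) :* (c :* w)) :* x
    :+ (con (+ 4) :* (a :* c) :- v :* v) :* y :+ (v :* w :- con (+ 2) :* (a :* u)) :* z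
  adj₃ᴾ x y z = (u :* w :- con (+ 2) :* (b :* v)) :* x
    :+ (v :* w :- con (+ 2) :* (a :* u)) :* y :+ (con (+ 4) :* (a :* b) :- w :* w) :* z
  adjValueᴾ x y z = x :* adj₁ᴾ x y z :+ y :* adj₂ᴾ x y z :+ z :* adj₃ᴾ x y z

  traceᴾ : (t x y z : Polynomial n) → Polynomial n
  traceᴾ t x y z = con (+ 2) :* t :+ (u :* x :+ v :* y :+ w :* z)

  gram₁ᴾ gram₂ᴾ gram₃ᴾ scalarPartᴾ : (x y z : Polynomial n) → Polynomial n
  gram₁ᴾ x y z = con (+ 2) :* a :* x :+ w :* y :+ v :* z
  gram₂ᴾ x y z = w :* x :+ con (+ 2) :* b :* y :+ u :* z
  gram₃ᴾ x y z = v :* x :+ u :* y :+ con (+ 2) :* c :* z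
  scalarPartᴾ x y z = :- ((a :* u :+ v :* w) :* x :+ (b :* v :+ u :* w) :* y :+ (c :* w :+ u :* v) :* z)

  -- The components of a product in Clf⁰.
  product₀ product₁ product₂ product₃ : (t x y z t′ x′ y′ z′ : Polynomial n) → Polynomial n
  product₀ t x y z t′ x′ y′ z′ =
    t :* t′
    :- b :* c :* (x :* x′) :- a :* c :* (y :* y′) :- a :* b :* (z :* z′)
    :+ a :* u :* (y :* z′) :- v :* w :* (z :* y′)
    :+ b :* v :* (z :* x′) :- u :* w :* (x :* z′)
    :+ c :* w :* (x :* y′) :- u :* v :* (y :* x′)
  product₁ t x y z t′ x′ y′ z′ =
    t :* x′ :+ x :* t′ :+ u :* (x :* x′)
    :- a :* (y :* z′) :+ a :* (z :* y′) :+ w :* (x :* z′) :+ v :* (y :* x′)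
  product₂ t x y z t′ x′ y′ z′ =
    t :* y′ :+ y :* t′ :+ v :* (y :* y′)
    :- b :* (z :* x′) :+ b :* (x :* z′) :+ w :* (z :* y′) :+ u :* (y :* x′)
  product₃ t x y z t′ x′ y′ z′ =
    t :* z′ :+ z :* t′ :+ w :* (z :* z′)
    :- c :* (x :* y′) :+ c :* (y :* x′) :+ v :* (z :* y′) :+ u :* (x :* z′)

module _ (F : TernaryForm) where
  open TernaryForm F
  open import Data.Integer.Base using (_+_; _*_; _-_; -_)
  open RawRing (Clf⁰ F) using () renaming (_*_ to _*ᶜ_)

  Clf : Set
  Clf = RawRing.Carrier (Clf⁰ F)

  re im₁ im₂ im₃ : Clf → ℤ
  re  (t , _ , _ , _) = t
  im₁ (_ , x , _ , _) = x
  im₂ (_ , _ , y , _) = y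
  im₃ (_ , _ , _ , z) = z

  Clf-≡ : ∀ {t t′ x x′ y y′ z z′ : ℤ} → t ≡ t′ → x ≡ x′ → y ≡ y′ → z ≡ z′ →
          (t , x , y , z) ≡ (t′ , x′ , y′ , z′)
  Clf-≡ p q r s = cong₂ _,_ p (cong₂ _,_ q (cong₂ _,_ r s))

  -- The reduced trace: by i² = ui - bc and its analogues, the traces of i, j, k are u, v, w.
  trace : Clf → ℤ
  trace (t , x , y , z) = + 2 * t + (u * x + v * y + w * z)

  gram₁ gram₂ gram₃ : (x y z : ℤ) → ℤ
  gram₁ x y z = + 2 * a * x + w * y + v * z
  gram₂ x y z = w * x + + 2 * b * y + u * z
  gram₃ x y z = v * x + u * y + + 2 * c * z

  -- The scalar part is -(uX + vY + wZ)/2, where (X , Y , Z) = M (x , y , z).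
  traceless : (x y z : ℤ) → Clf
  traceless x y z =
    - ((a * u + v * w) * x + (b * v + u * w) * y + (c * w + u * v) * z)
    , gram₁ x y z , gram₂ x y z , gram₃ x y z

  -- The coordinates of A X and the number ᵗX A X, where A is the adjugate of the Gram matrix M.
  adj₁ adj₂ adj₃ adjValue : (x y z : ℤ) → ℤ
  adj₁ x y z = (+ 4 * (b * c) - u * u) * x
    + (u * v - + 2 * (c * w)) * y + (u * w - + 2 * (b * v)) * z
  adj₂ x y z = (u * v - + 2 * (c * w)) * x
    + (+ 4 * (a * c) - v * v) * y + (v * w - + 2 * (a * u)) * z
  adj₃ x y z = (u * w - + 2 * (b * v)) * x
    + (v * w - + 2 * (a * u)) * y + (+ 4 * (a * b) - w * w) * z
  adjValue x y z = x * adj₁ x y z + y * adj₂ x y z + z * adj₃ x y z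

  -- Cayley-Hamilton: α² = Tα - N with trace T and norm N, and the scalar N has no imaginary part.
  im₁-square : ∀ t x y z → let α = (t , x , y , z) in im₁ (α *ᶜ α) ≡ x * trace α
  im₁-square = solve 10
    (λ a b c u v w t x y z →
      product₁ a b c u v w t x y z t x y z := x :* traceᴾ a b c u v w t x y z)
    ≡.refl a b c u v w

  im₂-square : ∀ t x y z → let α = (t , x , y , z) in im₂ (α *ᶜ α) ≡ y * trace α
  im₂-square = solve 10
    (λ a b c u v w t x y z →
      product₂ a b c u v w t x y z t x y z := y :* traceᴾ a b c u v w t x y z)
    ≡.refl a b c u v w

  im₃-square : ∀ t x y z → let α = (t , x , y , z) in im₃ (α *ᶜ α) ≡ z * trace α
  im₃-square = solve 10
    (λ a b c u v w t x y z →
      product₃ a b c u v w t x y z t x y z := z :* traceᴾ a b c u v w t x y z)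
    ≡.refl a b c u v w

  re-square-scalar : ∀ t → let α = (t , 0ℤ , 0ℤ , 0ℤ) in re (α *ᶜ α) ≡ t * t
  re-square-scalar = solve 7
    (λ a b c u v w t →
      let o = con 0ℤ in product₀ a b c u v w t o o o t o o o := t :* t)
    ≡.refl a b c u v w

  -- With trace T and norm N, re(α²) = Tt - N, so the right-hand side is 4N - T². Thus ᵗX A X is
  -- minus the discriminant of the characteristic polynomial of α, which does not change when an
  -- integer is added to α.
  adjValue-trace : ∀ t x y z → let α = (t , x , y , z) in
    adjValue x y z ≡ (+ 2 * t - (u * x + v * y + w * z)) * trace α - + 4 * re (α *ᶜ α)
  adjValue-trace = solve 10
    (λ a b c u v w t x y z →
      adjValueᴾ a b c u v w x y z
      := (con (+ 2) :* t :- (u :* x :+ v :* y :+ w :* z)) :* traceᴾ a b c u v w t x y z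
         :- con (+ 4) :* product₀ a b c u v w t x y z t x y z)
    ≡.refl a b c u v w

  trace-traceless : ∀ x y z → trace (traceless x y z) ≡ 0ℤ
  trace-traceless = solve 9
    (λ a b c u v w x y z →
      traceᴾ a b c u v w (scalarPartᴾ a b c u v w x y z)
        (gram₁ᴾ a b c u v w x y z) (gram₂ᴾ a b c u v w x y z) (gram₃ᴾ a b c u v w x y z)
      := con 0ℤ)
    ≡.refl a b c u v w

  -- For X = M v, the number ᵗX A X is det M · F(v), that is, twice the discriminant times F(v). It
  -- also equals 4N, since the trace is zero, and α² = -N.
  re-square-traceless : ∀ x y z → let α = traceless x y z in
    + 2 * re (α *ᶜ α) ≡ - (discriminant F * value F x y z)
  re-square-traceless = solve 9
    (λ a b c u v w x y z →
      let
        t  = scalarPartᴾ a b c u v w x y z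
        x′ = gram₁ᴾ a b c u v w x y z
        y′ = gram₂ᴾ a b c u v w x y z
        z′ = gram₃ᴾ a b c u v w x y z
      in
      con (+ 2) :* product₀ a b c u v w t x′ y′ z′ t x′ y′ z′
      := :- (discriminantᴾ a b c u v w :* valueᴾ a b c u v w x y z))
    ≡.refl a b c u v w

  -- The difference of (A X)₁² and A₁₁ ᵗX A X is a quadratic form in X whose coefficients come from
  -- 2 × 2 minors of A. By Jacobi's identity these are, up to sign, det M times entries of M, and
  -- det M is twice the discriminant.
  adj₁-square : ∀ x y z → adj₁ x y z * adj₁ x y z ≡
    (+ 4 * (b * c) - u * u) * adjValue x y z
    - + 4 * (c * (y * y) + b * (z * z) - u * (y * z)) * discriminant F
  adj₁-square = solve 9
    (λ a b c u v w x y z →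
      adj₁ᴾ a b c u v w x y z :* adj₁ᴾ a b c u v w x y z
      := (con (+ 4) :* (b :* c) :- u :* u) :* adjValueᴾ a b c u v w x y z
         :- con (+ 4) :* (c :* (y :* y) :+ b :* (z :* z) :- u :* (y :* z)) :* discriminantᴾ a b c u v w)
    ≡.refl a b c u v w

  adj₂-square : ∀ x y z → adj₂ x y z * adj₂ x y z ≡
    (+ 4 * (a * c) - v * v) * adjValue x y z
    - + 4 * (c * (x * x) + a * (z * z) - v * (x * z)) * discriminant F
  adj₂-square = solve 9
    (λ a b c u v w x y z →
      adj₂ᴾ a b c u v w x y z :* adj₂ᴾ a b c u v w x y z
      := (con (+ 4) :* (a :* c) :- v :* v) :* adjValueᴾ a b c u v w x y z
         :- con (+ 4) :* (c :* (x :* x) :+ a :* (z :* z) :- v :* (x :* z)) :* discriminantᴾ a b c u v w)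
    ≡.refl a b c u v w

  adj₃-square : ∀ x y z → adj₃ x y z * adj₃ x y z ≡
    (+ 4 * (a * b) - w * w) * adjValue x y z
    - + 4 * (b * (x * x) + a * (y * y) - w * (x * y)) * discriminant F
  adj₃-square = solve 9
    (λ a b c u v w x y z →
      adj₃ᴾ a b c u v w x y z :* adj₃ᴾ a b c u v w x y z
      := (con (+ 4) :* (a :* b) :- w :* w) :* adjValueᴾ a b c u v w x y z
         :- con (+ 4) :* (b :* (x :* x) :+ a :* (y :* y) :- w :* (x :* y)) :* discriminantᴾ a b c u v w)
    ≡.refl a b c u v w

  -- Modulo 2, A is the column (u , v , w) times its transpose, and the trace is ux + vy + wz. The
  -- term `- u * t` cancels the 2t inside the trace.
  adj₁-trace : ∀ t x y z → adj₁ x y z ≡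
    u * trace (t , x , y , z)
    + (+ 2 * (b * c) * x - c * w * y - b * v * z - u * u * x - u * t) * + 2
  adj₁-trace = solve 10
    (λ a b c u v w t x y z →
      adj₁ᴾ a b c u v w x y z
      := u :* traceᴾ a b c u v w t x y z
         :+ (con (+ 2) :* (b :* c) :* x :- c :* w :* y :- b :* v :* z :- u :* u :* x :- u :* t) :* con (+ 2))
    ≡.refl a b c u v w

  adj₂-trace : ∀ t x y z → adj₂ x y z ≡
    v * trace (t , x , y , z)
    + (+ 2 * (a * c) * y - c * w * x - a * u * z - v * v * y - v * t) * + 2
  adj₂-trace = solve 10
    (λ a b c u v w t x y z →
      adj₂ᴾ a b c u v w x y z
      := v :* traceᴾ a b c u v w t x y z
         :+ (con (+ 2) :* (a :* c) :* y :- c :* w :* x :- a :* u :* z :- v :* v :* y :- v :* t) :* con (+ 2))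
    ≡.refl a b c u v w

  adj₃-trace : ∀ t x y z → adj₃ x y z ≡
    w * trace (t , x , y , z)
    + (+ 2 * (a * b) * z - b * v * x - a * u * y - w * w * z - w * t) * + 2
  adj₃-trace = solve 10
    (λ a b c u v w t x y z →
      adj₃ᴾ a b c u v w x y z
      := w :* traceᴾ a b c u v w t x y z
         :+ (con (+ 2) :* (a :* b) :* z :- b :* v :* x :- a :* u :* y :- w :* w :* z :- w :* t) :* con (+ 2))
    ≡.refl a b c u v w

  -- Since A is symmetric and M A = det M, ᵗ(A X) M (A X) = det M · ᵗX A X.
  value-adj : ∀ x y z →
    value F (adj₁ x y z) (adj₂ x y z) (adj₃ x y z) ≡ + 2 * discriminant F * adjValue x y z
  value-adj = solve 9
    (λ a b c u v w x y z →
      valueᴾ a b c u v w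
        (adj₁ᴾ a b c u v w x y z) (adj₂ᴾ a b c u v w x y z) (adj₃ᴾ a b c u v w x y z)
      := con (+ 2) :* discriminantᴾ a b c u v w :* adjValueᴾ a b c u v w x y z)
    ≡.refl a b c u v w

  value-homogeneous : ∀ k x y z → value F (x * k) (y * k) (z * k) ≡ k * k * value F x y z
  value-homogeneous = solve 10
    (λ a b c u v w k x y z →
      valueᴾ a b c u v w (x :* k) (y :* k) (z :* k)
      := k :* k :* valueᴾ a b c u v w x y z)
    ≡.refl a b c u v w

  2∣value : ∀ x y z → + 2 ℤ.∣ value F x y z
  2∣value x y z = divides
    (a * (x * x) + b * (y * y) + c * (z * z) + u * (y * z) + v * (x * z) + w * (x * y)) (solve 9
    (λ a b c u v w x y z →
      valueᴾ a b c u v w x y z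
      := (a :* (x :* x) :+ b :* (y :* y) :+ c :* (z :* z)
         :+ u :* (y :* z) :+ v :* (x :* z) :+ w :* (x :* y)) :* con (+ 2))
    ≡.refl a b c u v w x y z)

-- Quadratic orders in Clf⁰

  fromOrder : Clf → ℤ × ℤ → Clf
  fromOrder (t , x , y , z) (m , n) = m + n * t , n * x , n * y , n * z

  module _ (t x y z ν : ℤ) where
    open RawRing (quadraticOrder 0ℤ ν) using () renaming (_*_ to _*ᴼ_)

    private
      α : Clf
      α = t , x , y , z

    -- `fromOrder α` sends √-ν to α. For arbitrary α it fails to be multiplicative by exactly nn′(α²
    -- + ν). Keeping this error term makes each component a polynomial identity, and
    -- `drop-vanishing` removes it once α² = -ν.
    re-fromOrder-* : ∀ m n m′ n′ →
      re (fromOrder α (m , n) *ᶜ fromOrder α (m′ , n′))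
      ≡ re (fromOrder α ((m , n) *ᴼ (m′ , n′))) + n * n′ * (re (α *ᶜ α) - - ν)
    re-fromOrder-* = solve 15
      (λ a b c u v w t x y z ν m n m′ n′ →
        product₀ a b c u v w
          (m :+ n :* t) (n :* x) (n :* y) (n :* z) (m′ :+ n′ :* t) (n′ :* x) (n′ :* y) (n′ :* z)
        := m :* m′ :- ν :* (n :* n′) :+ (m :* n′ :+ n :* m′ :+ con 0ℤ :* (n :* n′)) :* t
           :+ n :* n′ :* (product₀ a b c u v w t x y z t x y z :- :- ν))
      ≡.refl a b c u v w t x y z ν

    im₁-fromOrder-* : ∀ m n m′ n′ →
      im₁ (fromOrder α (m , n) *ᶜ fromOrder α (m′ , n′))
      ≡ im₁ (fromOrder α ((m , n) *ᴼ (m′ , n′))) + n * n′ * (im₁ (α *ᶜ α) - 0ℤ)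
    im₁-fromOrder-* = solve 14
      (λ a b c u v w t x y z m n m′ n′ →
        product₁ a b c u v w
          (m :+ n :* t) (n :* x) (n :* y) (n :* z) (m′ :+ n′ :* t) (n′ :* x) (n′ :* y) (n′ :* z)
        := (m :* n′ :+ n :* m′ :+ con 0ℤ :* (n :* n′)) :* x
           :+ n :* n′ :* (product₁ a b c u v w t x y z t x y z :- con 0ℤ))
      ≡.refl a b c u v w t x y z

    im₂-fromOrder-* : ∀ m n m′ n′ →
      im₂ (fromOrder α (m , n) *ᶜ fromOrder α (m′ , n′))
      ≡ im₂ (fromOrder α ((m , n) *ᴼ (m′ , n′))) + n * n′ * (im₂ (α *ᶜ α) - 0ℤ)
    im₂-fromOrder-* = solve 14
      (λ a b c u v w t x y z m n m′ n′ →
        product₂ a b c u v w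
          (m :+ n :* t) (n :* x) (n :* y) (n :* z) (m′ :+ n′ :* t) (n′ :* x) (n′ :* y) (n′ :* z)
        := (m :* n′ :+ n :* m′ :+ con 0ℤ :* (n :* n′)) :* y
           :+ n :* n′ :* (product₂ a b c u v w t x y z t x y z :- con 0ℤ))
      ≡.refl a b c u v w t x y z

    im₃-fromOrder-* : ∀ m n m′ n′ →
      im₃ (fromOrder α (m , n) *ᶜ fromOrder α (m′ , n′))
      ≡ im₃ (fromOrder α ((m , n) *ᴼ (m′ , n′))) + n * n′ * (im₃ (α *ᶜ α) - 0ℤ)
    im₃-fromOrder-* = solve 14
      (λ a b c u v w t x y z m n m′ n′ →
        product₃ a b c u v w
          (m :+ n :* t) (n :* x) (n :* y) (n :* z) (m′ :+ n′ :* t) (n′ :* x) (n′ :* y) (n′ :* z)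
        := (m :* n′ :+ n :* m′ :+ con 0ℤ :* (n :* n′)) :* z
           :+ n :* n′ :* (product₃ a b c u v w t x y z t x y z :- con 0ℤ))
      ≡.refl a b c u v w t x y z

  IsSquareRootOf- : ℕ → Clf → Set
  IsSquareRootOf- n α = α *ᶜ α ≡ (- + n , 0ℤ , 0ℤ , 0ℤ)

  module _ {n} .{{_ : NonZero n}} {α : Clf} (α²≡-n : IsSquareRootOf- n α) where

    -- Otherwise α would be an integer with negative square.
    imaginary-nonzero : ¬ (im₁ α ≡ 0ℤ × im₂ α ≡ 0ℤ × im₃ α ≡ 0ℤ)
    imaginary-nonzero (≡.refl , ≡.refl , ≡.refl) =
      square≢- (re α) n (≡.trans (≡.sym (re-square-scalar (re α))) (cong re α²≡-n))

    -- ℤ is a domain and some imaginary coordinate is nonzero. It is applied to the trace of α and,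
    -- for injectivity, to a difference of coefficients of α.
    annihilator-zero : ∀ {k} → im₁ α * k ≡ 0ℤ → im₂ α * k ≡ 0ℤ → im₃ α * k ≡ 0ℤ → k ≡ 0ℤ
    annihilator-zero xk≡0 yk≡0 zk≡0
      with ℤ.i*j≡0⇒i≡0∨j≡0 (im₁ α) xk≡0 | ℤ.i*j≡0⇒i≡0∨j≡0 (im₂ α) yk≡0
         | ℤ.i*j≡0⇒i≡0∨j≡0 (im₃ α) zk≡0
    ... | inj₂ k≡0 | _        | _        = k≡0
    ... | inj₁ _   | inj₂ k≡0 | _        = k≡0
    ... | inj₁ _   | inj₁ _   | inj₂ k≡0 = k≡0
    ... | inj₁ x≡0 | inj₁ y≡0 | inj₁ z≡0 = contradiction (x≡0 , y≡0 , z≡0) imaginary-nonzero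

    trace-zero : trace α ≡ 0ℤ
    trace-zero = annihilator-zero
      (≡.trans (≡.sym (im₁-square (re α) (im₁ α) (im₂ α) (im₃ α))) (cong im₁ α²≡-n))
      (≡.trans (≡.sym (im₂-square (re α) (im₁ α) (im₂ α) (im₃ α))) (cong im₂ α²≡-n))
      (≡.trans (≡.sym (im₃-square (re α) (im₁ α) (im₂ α) (im₃ α))) (cong im₃ α²≡-n))

    fromOrder-injective : ∀ {r s} → fromOrder α r ≡ fromOrder α s → r ≡ s
    fromOrder-injective {m , k} {m′ , k′} eq
      -- The imaginary parts of the two images differ by (k - k′)X, whence k = k′; then kt cancels
      -- from the real parts.
      with ℤ.i-j≡0⇒i≡j k k′ (annihilator-zero
             (difference (cong im₁ eq)) (difference (cong im₂ eq)) (difference (cong im₃ eq)))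
      where
      difference : ∀ {i} → k * i ≡ k′ * i → i * (k - k′) ≡ 0ℤ
      difference {i} ki≡k′i = begin
        i * (k - k′)     ≡⟨ solve 3 (λ i k k′ → i :* (k :- k′) := k :* i :- k′ :* i) ≡.refl i k k′ ⟩
        k * i - k′ * i   ≡⟨ ℤ.i≡j⇒i-j≡0 ki≡k′i ⟩
        0ℤ               ∎
        where open ≡.≡-Reasoning
    ... | ≡.refl = cong (_, k) (+-cancelʳ (k * re α) m m′ (cong re eq))
      where open Algebra.Properties.Group (AbelianGroup.group ℤ.+-0-abelianGroup) using () renaming (∙-cancelʳ to +-cancelʳ)

    fromOrder-isRingMonomorphism :
      RingMorphisms.IsRingMonomorphism ℤ[√- n ] (Clf⁰ F) (fromOrder α)
    fromOrder-isRingMonomorphism = record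
      { isRingHomomorphism = record
        { isSemiringHomomorphism = record
          { isNearSemiringHomomorphism = record
            { +-isMonoidHomomorphism = record
              { isMagmaHomomorphism = record
                { isRelHomomorphism = record { cong = cong (fromOrder α) }
                ; homo = λ (m , k) (m′ , k′) → Clf-≡
                    (solve 5 (λ m k m′ k′ t → m :+ m′ :+ (k :+ k′) :* t
                                          := m :+ k :* t :+ (m′ :+ k′ :* t)) ≡.refl m k m′ k′ _)
                    (ℤ.*-distribʳ-+ _ k k′) (ℤ.*-distribʳ-+ _ k k′) (ℤ.*-distribʳ-+ _ k k′)
                }
              ; ε-homo = ≡.refl
              }
            ; *-homo = λ (m , k) (m′ , k′) → ≡.sym (Clf-≡
                (drop-vanishing (k * k′) (re-fromOrder-* (re α) (im₁ α) (im₂ α) (im₃ α) (+ n) m k m′ k′) (cong re α²≡-n))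
                (drop-vanishing (k * k′) (im₁-fromOrder-* (re α) (im₁ α) (im₂ α) (im₃ α) (+ n) m k m′ k′) (cong im₁ α²≡-n))
                (drop-vanishing (k * k′) (im₂-fromOrder-* (re α) (im₁ α) (im₂ α) (im₃ α) (+ n) m k m′ k′) (cong im₂ α²≡-n))
                (drop-vanishing (k * k′) (im₃-fromOrder-* (re α) (im₁ α) (im₂ α) (im₃ α) (+ n) m k m′ k′) (cong im₃ α²≡-n)))
            }
          ; 1#-homo = ≡.refl
          }
        ; -‿homo = λ (m , k) → Clf-≡
            (solve 3 (λ m k t → :- m :+ :- k :* t := :- (m :+ k :* t)) ≡.refl m k _)
            (≡.sym (ℤ.neg-distribˡ-* k _)) (≡.sym (ℤ.neg-distribˡ-* k _))
            (≡.sym (ℤ.neg-distribˡ-* k _))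
        }
      ; injective = fromOrder-injective
      }

  value-multiple :
    ∀ {x y z} k x′ y′ z′ → x ≡ x′ * k → y ≡ y′ * k → z ≡ z′ * k →
    value F x y z ≡ k * k * value F x′ y′ z′
  value-multiple k x′ y′ z′ ≡.refl ≡.refl ≡.refl = value-homogeneous k x′ y′ z′

-- Square roots of -np in Clf⁰ and representations of 2n

  module _ {p} (p-prime : Prime p) (disc≡p : discriminant F ≡ + p) (n : ℕ) where

    private
      instance
        p≢0 : NonZero p
        p≢0 = prime⇒nonZero p-prime

    representation⇒squareRoot :
      ∀ x y z → value F x y z ≡ + (2 ℕ.* n) → IsSquareRootOf- (n ℕ.* p) (traceless x y z)
    representation⇒squareRoot x y z value≡2n = Clf-≡
      -- The trace identity determines 2 re(α²) = -p·2n, so the real part is compared after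
      -- doubling; the imaginary parts are multiples of the zero trace.
      (ℤ.*-cancelˡ-≡ (+ 2) _ _ (begin
        + 2 * re (α *ᶜ α)                  ≡⟨ re-square-traceless x y z ⟩
        - (discriminant F * value F x y z) ≡⟨ cong₂ (λ i j → - (i * j)) disc≡p value≡2n ⟩
        - (+ p * + (2 ℕ.* n))              ≡⟨ cong (λ i → - (+ p * i)) (ℤ.pos-* 2 n) ⟩
        - (+ p * (+ 2 * + n))              ≡⟨ solve 2 (λ p n → :- (p :* (con (+ 2) :* n)) := con (+ 2) :* :- (n :* p)) ≡.refl (+ p) (+ n) ⟩
        + 2 * - (+ n * + p)                ≡⟨ cong (λ i → + 2 * - i) (ℤ.pos-* n p) ⟨
        + 2 * - + (n ℕ.* p)                ∎))
      (vanish (im₁ α) (im₁-square (re α) (im₁ α) (im₂ α) (im₃ α)))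
      (vanish (im₂ α) (im₂-square (re α) (im₁ α) (im₂ α) (im₃ α)))
      (vanish (im₃ α) (im₃-square (re α) (im₁ α) (im₂ α) (im₃ α)))
      where
      open ≡.≡-Reasoning
      α = traceless x y z

      vanish : ∀ {i} j → i ≡ j * trace α → i ≡ 0ℤ
      vanish {i} j i≡ = begin
        i           ≡⟨ i≡ ⟩
        j * trace α ≡⟨ cong (j *_) (trace-traceless x y z) ⟩
        j * 0ℤ      ≡⟨ ℤ.*-zeroʳ j ⟩
        0ℤ          ∎

    module _ .{{_ : NonZero n}} (2<p : 2 ℕ.< p) where

      -- The vector is A X / 2p, where X is the imaginary part of α. Its value is 2n because F(A X)
      -- = 2p · ᵗX A X = 2p · 4np = (2p)² · 2n.
      squareRoot⇒representation :
        ∀ {α} → IsSquareRootOf- (n ℕ.* p) α →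
        ∃ λ x → ∃ λ y → ∃ λ z → value F x y z ≡ + (2 ℕ.* n)
      squareRoot⇒representation {α@(t , x , y , z)} α²≡-np =
        quotients
          (2p∣ p-prime 2<p (adj₁ x y z)
            (p∣adj (adj₁ x y z) (+ 4 * (b * c) - u * u) (+ 4 * (c * (y * y) + b * (z * z) - u * (y * z)))
              (adj₁-square x y z))
            (2∣adj (adj₁ x y z) u (+ 2 * (b * c) * x - c * w * y - b * v * z - u * u * x - u * t)
              (adj₁-trace t x y z)))
          (2p∣ p-prime 2<p (adj₂ x y z)
            (p∣adj (adj₂ x y z) (+ 4 * (a * c) - v * v) (+ 4 * (c * (x * x) + a * (z * z) - v * (x * z)))
              (adj₂-square x y z))
            (2∣adj (adj₂ x y z) v (+ 2 * (a * c) * y - c * w * x - a * u * z - v * v * y - v * t)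
              (adj₂-trace t x y z)))
          (2p∣ p-prime 2<p (adj₃ x y z)
            (p∣adj (adj₃ x y z) (+ 4 * (a * b) - w * w) (+ 4 * (b * (x * x) + a * (y * y) - w * (x * y)))
              (adj₃-square x y z))
            (2∣adj (adj₃ x y z) w (+ 2 * (a * b) * z - b * v * x - a * u * y - w * w * z - w * t)
              (adj₃-trace t x y z)))
        where
        open ≡.≡-Reasoning
        k = + 2 * + p

        instance
          k≢0 : ℤ.NonZero k
          k≢0 = ℤ.i*j≢0 (+ 2) (+ p)

          np≢0 : NonZero (n ℕ.* p)
          np≢0 = ℕ.m*n≢0 n p

        trace≡0 : trace α ≡ 0ℤ
        trace≡0 = trace-zero {n = n ℕ.* p} {α = α} α²≡-np

        adjValue≡4np : adjValue x y z ≡ + 4 * (+ n * + p)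
        adjValue≡4np = begin
          adjValue x y z                         ≡⟨ adjValue-trace t x y z ⟩
          l * trace α - + 4 * re (α *ᶜ α)        ≡⟨ cong₂ (λ i j → l * i - + 4 * j) trace≡0 (cong re α²≡-np) ⟩
          l * 0ℤ - + 4 * - + (n ℕ.* p)           ≡⟨ solve 2 (λ l m → l :* con 0ℤ :- con (+ 4) :* :- m := con (+ 4) :* m) ≡.refl l (+ (n ℕ.* p)) ⟩
          + 4 * + (n ℕ.* p)                      ≡⟨ cong (+ 4 *_) (ℤ.pos-* n p) ⟩
          + 4 * (+ n * + p)                      ∎
          where l = + 2 * t - (u * x + v * y + w * z)

        value-adj≡ : value F (adj₁ x y z) (adj₂ x y z) (adj₃ x y z) ≡ k * k * + (2 ℕ.* n)
        value-adj≡ = begin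
          value F (adj₁ x y z) (adj₂ x y z) (adj₃ x y z)
            ≡⟨ value-adj x y z ⟩
          + 2 * discriminant F * adjValue x y z
            ≡⟨ cong₂ (λ i j → + 2 * i * j) disc≡p adjValue≡4np ⟩
          + 2 * + p * (+ 4 * (+ n * + p))
            ≡⟨ solve 2 (λ p n → con (+ 2) :* p :* (con (+ 4) :* (n :* p))
                 := con (+ 2) :* p :* (con (+ 2) :* p) :* (con (+ 2) :* n)) ≡.refl (+ p) (+ n) ⟩
          k * k * (+ 2 * + n)
            ≡⟨ cong (λ i → k * k * i) (ℤ.pos-* 2 n) ⟨
          k * k * + (2 ℕ.* n)
            ∎

        quotients : (∃ λ x′ → adj₁ x y z ≡ x′ * k) → (∃ λ y′ → adj₂ x y z ≡ y′ * k) →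
                    (∃ λ z′ → adj₃ x y z ≡ z′ * k) →
                    ∃ λ x′ → ∃ λ y′ → ∃ λ z′ → value F x′ y′ z′ ≡ + (2 ℕ.* n)
        quotients (x′ , adj₁≡) (y′ , adj₂≡) (z′ , adj₃≡) =
          x′ , y′ , z′ , ℤ.*-cancelˡ-≡ (k * k) (value F x′ y′ z′) (+ (2 ℕ.* n)) {{ℤ.i*j≢0 k k}}
            (≡.trans (≡.sym (value-multiple k x′ y′ z′ adj₁≡ adj₂≡ adj₃≡)) value-adj≡)

        -- Both terms on the right are multiples of p, as ᵗX A X = 4np and the discriminant is p; a
        -- prime dividing i² divides i.
        p∣adj : ∀ i q r → i * i ≡ q * adjValue x y z - r * discriminant F → + p ℤ.∣ i
        p∣adj i q r i²≡ = prime∣square p-prime i (divides (q * (+ 4 * + n) - r) (begin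
          i * i                                       ≡⟨ i²≡ ⟩
          q * adjValue x y z - r * discriminant F     ≡⟨ cong₂ (λ i j → q * i - r * j) adjValue≡4np disc≡p ⟩
          q * (+ 4 * (+ n * + p)) - r * + p           ≡⟨ solve 4 (λ q r n p → q :* (con (+ 4) :* (n :* p)) :- r :* p
                                                           := (q :* (con (+ 4) :* n) :- r) :* p) ≡.refl q r (+ n) (+ p) ⟩
          (q * (+ 4 * + n) - r) * + p                 ∎))

        2∣adj : ∀ i q r → i ≡ q * trace α + r * + 2 → + 2 ℤ.∣ i
        2∣adj i q r i≡ = divides r (begin
          i                      ≡⟨ i≡ ⟩
          q * trace α + r * + 2  ≡⟨ cong (λ j → q * j + r * + 2) trace≡0 ⟩
          q * 0ℤ + r * + 2       ≡⟨ cong (_+ r * + 2) (ℤ.*-zeroʳ q) ⟩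
          0ℤ + r * + 2           ≡⟨ ℤ.+-identityˡ _ ⟩
          r * + 2                ∎)

  -- If g is the gcd of the coordinates, then 2q is g² times another value of F, which is even.
  twice-prime-proper : ∀ {q} → Prime q → ∀ x y z → value F x y z ≡ + (2 ℕ.* q) →
                       ℤ.gcd (ℤ.gcd x y) z ≡ 1ℤ
  twice-prime-proper {q} q-prime x y z value≡2q = cong (λ m → + m)
    (content≡1
      (ℤ.∣ᵤ⇒∣ {+ g} {x} (ℕ.∣-trans g∣gcd[x,y] (ℕ.gcd[m,n]∣m ∣ x ∣ ∣ y ∣)))
      (ℤ.∣ᵤ⇒∣ {+ g} {y} (ℕ.∣-trans g∣gcd[x,y] (ℕ.gcd[m,n]∣n ∣ x ∣ ∣ y ∣)))
      (ℤ.∣ᵤ⇒∣ {+ g} {z} (ℕ.gcd[m,n]∣n (ℕ.gcd ∣ x ∣ ∣ y ∣) ∣ z ∣)))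
    where
    g = ℕ.gcd (ℕ.gcd ∣ x ∣ ∣ y ∣) ∣ z ∣
    g∣gcd[x,y] = ℕ.gcd[m,n]∣m (ℕ.gcd ∣ x ∣ ∣ y ∣) ∣ z ∣

    content≡1 : + g ℤ.∣ x → + g ℤ.∣ y → + g ℤ.∣ z → g ≡ 1
    content≡1 (divides x′ x≡) (divides y′ y≡) (divides z′ z≡) =
      square∣twice-prime q-prime g (2∣value x′ y′ z′)
        (≡.trans (≡.sym (value-multiple (+ g) x′ y′ z′ x≡ y≡ z≡)) value≡2q)

-- Orientations

-- Translates the n-fold sum of 1, on which `embedding-multiple` is stated, into coordinates.
quadraticOrder-multiple : ∀ τ ν n → let open RawRing (quadraticOrder τ ν) in
  Algebra.Definitions.RawMonoid._×_ +-rawMonoid n 1# ≡ (+ n , 0ℤ)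
quadraticOrder-multiple τ ν zero    = ≡.refl
quadraticOrder-multiple τ ν (suc n) = cong (λ r → 1# + r) (quadraticOrder-multiple τ ν n)
  where open RawRing (quadraticOrder τ ν)

Clf⁰-multiple : ∀ F n → let open RawRing (Clf⁰ F) in
  Algebra.Definitions.RawMonoid._×_ +-rawMonoid n 1# ≡ (+ n , 0ℤ , 0ℤ , 0ℤ)
Clf⁰-multiple F zero    = ≡.refl
Clf⁰-multiple F (suc n) = cong (λ r → 1# + r) (Clf⁰-multiple F n)
  where open RawRing (Clf⁰ F)

module _ {κ ℓ} {K : DiscreteField κ ℓ} {E : EllipticCurve K}
         {F : TernaryForm} (End≅Clf⁰ : EndomorphismRing≅ E (Clf⁰ F)) where
  open GroupLaw E
  open EndomorphismRing≅ End≅Clf⁰ using (ringEmbedding; surjective)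
  module Clf where
    open EndomorphismRing≅ End≅Clf⁰ public using (embedding; isEndomorphism; isRingMonomorphism)
    open RingMorphisms.IsRingMonomorphism isRingMonomorphism public
    open RawRing (Clf⁰ F) public using (_*_)

  squareRoot⇒oriented : ∀ n .{{_ : NonZero n}} {α} →
    IsSquareRootOf- F n α → IsOriented ℤ[√- n ] E
  squareRoot⇒oriented n {α} α²≡-n =
    precompose E (fromOrder F α) (fromOrder-isRingMonomorphism F {n} {α} α²≡-n) ringEmbedding

  -- By surjectivity of Clf⁰(F) → End(E), the image of ε comes from some α. Both α² and -n act on
  -- points as -n, so injectivity gives α² = -n. A general ε covers both orders: it will be √-n in
  -- one and 2θ - 1 in the other.
  oriented⇒squareRoot : ∀ n {τ ν} → let open RawRing (quadraticOrder τ ν) using (_*_) in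
    ∀ ε → ε * ε ≡ (ℤ.- + n , 0ℤ) →
    IsOriented (quadraticOrder τ ν) E → ∃ (IsSquareRootOf- F n)
  oriented⇒squareRoot n {τ} {ν} ε ε²≡-n f = α , Clf.injective {α Clf.* α} {ℤ.- + n , 0ℤ , 0ℤ , 0ℤ} α²≈-n
    where
    module R where
      open RingEmbedding f public
      open RingMorphisms.IsRingMonomorphism isRingMonomorphism public
      open RawRing (quadraticOrder τ ν) public using (_*_)

    α = proj₁ (surjective (R.embedding ε) (R.isEndomorphism ε))

    α≈ε : ∀ P → Clf.embedding α P ≈ₚ R.embedding ε P
    α≈ε = proj₂ (surjective (R.embedding ε) (R.isEndomorphism ε))

    -n∈R : ∀ P → R.embedding (ℤ.- + n , 0ℤ) P ≈ₚ opposite (n ·ₚ P)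
    -n∈R P = ≡.subst (λ r → R.embedding (RawRing.-_ (quadraticOrder τ ν) r) P ≈ₚ opposite (n ·ₚ P))
      (quadraticOrder-multiple τ ν n) (embedding-negMultiple E (quadraticOrder τ ν) f n P)

    -n∈Clf : ∀ P → Clf.embedding (ℤ.- + n , 0ℤ , 0ℤ , 0ℤ) P ≈ₚ opposite (n ·ₚ P)
    -n∈Clf P = ≡.subst (λ r → Clf.embedding (RawRing.-_ (Clf⁰ F) r) P ≈ₚ opposite (n ·ₚ P))
      (Clf⁰-multiple F n) (embedding-negMultiple E (Clf⁰ F) ringEmbedding n P)

    infixr 2 _∙_
    _∙_ : ∀ {P Q R} → P ≈ₚ Q → Q ≈ₚ R → P ≈ₚ R
    _∙_ = ≈ₚ-trans E

    α²≈-n : ∀ P → Clf.embedding (α Clf.* α) P ≈ₚ Clf.embedding (ℤ.- + n , 0ℤ , 0ℤ , 0ℤ) P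
    α²≈-n P =
      Clf.*-homo α α P
      -- Replace α by ε first in the inner factor, where the endomorphism must respect `_≈ₚ_`, and
      -- then in the outer one.
      ∙ Endomorphisms.IsEndomorphism.cong (Clf.isEndomorphism α) (α≈ε P)
      ∙ α≈ε (R.embedding ε P)
      ∙ ≈ₚ-sym E (R.*-homo ε ε P)
      ∙ ≡.subst (λ r → R.embedding r P ≈ₚ opposite (n ·ₚ P)) (≡.sym ε²≡-n) (-n∈R P)
      ∙ ≈ₚ-sym E (-n∈Clf P)

√-n-square : ∀ n → RawRing._*_ ℤ[√- n ] (0ℤ , 1ℤ) (0ℤ , 1ℤ) ≡ (ℤ.- + n , 0ℤ)
√-n-square n = cong (_, 0ℤ) (≡.trans (ℤ.+-identityˡ _) (cong ℤ.-_ (ℤ.*-identityʳ (+ n))))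

-- √-n = 2θ - 1 for θ = (1 + √-n)/2.
2θ-1-square : ∀ n (4∣1+n : 4 ∣ 1 ℕ.+ n) →
  RawRing._*_ (ℤ[1+√- n /2] 4∣1+n) (ℤ.-1ℤ , + 2) (ℤ.-1ℤ , + 2) ≡ (ℤ.- + n , 0ℤ)
2θ-1-square n (ℕ.divides q 1+n≡4q) = cong (_, 0ℤ) (begin
  1ℤ ℤ.- + q ℤ.* + 4   ≡⟨ cong (λ m → 1ℤ ℤ.- m) (ℤ.pos-* q 4) ⟨
  1ℤ ℤ.- + (q ℕ.* 4)   ≡⟨ cong (λ m → 1ℤ ℤ.- + m) 1+n≡4q ⟨
  1ℤ ℤ.- + (1 ℕ.+ n)   ≡⟨ solve 1 (λ n → con 1ℤ :- (con 1ℤ :+ n) := :- n) ≡.refl (+ n) ⟩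
  ℤ.- + n              ∎)
  where open ≡.≡-Reasoning

open import Data.Nat.Base using (_+_; _*_; _^_; _<_)

mainTheorem6 : ∀ {κ ℓ} (p : ℕ) → Prime p → 3 < p →
    (K : DiscreteField κ ℓ) → IsAlgebraicClosureOf𝔽 p K →
    (E : EllipticCurve K) → IsDefinedOver𝔽 (p ^ 2) E → IsSupersingular p E →
    (F : TernaryForm) → discriminant F ≡ + p → EndomorphismRing≅ E (Clf⁰ F) →
    (c : ℕ) → Prime c → 16 * c < 3 * p →
    ProperlyRepresents F (+ (2 * c))
    ⇔ (IsOriented ℤ[√- c * p ] E
    ⊎ Σ (4 ∣ 1 + c * p) (λ d → IsOriented (ℤ[1+√- c * p /2] d) E))
mainTheorem6 p p-prime 3<p K _ E _ _ F disc≡p End≅Clf⁰ c c-prime _ = mk⇔ to from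
  where
  instance
    p≢0 : NonZero p
    p≢0 = prime⇒nonZero p-prime
    c≢0 : NonZero c
    c≢0 = prime⇒nonZero c-prime

  Oriented : Set _
  Oriented = IsOriented ℤ[√- c * p ] E ⊎ Σ (4 ∣ 1 + c * p) (λ d → IsOriented (ℤ[1+√- c * p /2] d) E)

  to : ProperlyRepresents F (+ (2 * c)) → Oriented
  -- The first alternative always holds here: the traceless element has square -cp and so generates
  -- a copy of ℤ[√-cp]. If the larger order embeds, this one does too.
  to (x , y , z , _ , value≡2c) = inj₁ (squareRoot⇒oriented {F = F} End≅Clf⁰ (c * p) {{ℕ.m*n≢0 c p}} {traceless F x y z}
    (representation⇒squareRoot F p-prime disc≡p c x y z value≡2c))

  proper : (∃ λ x → ∃ λ y → ∃ λ z → value F x y z ≡ + (2 * c)) →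
           ProperlyRepresents F (+ (2 * c))
  proper (x , y , z , value≡2c) =
    x , y , z , twice-prime-proper F c-prime x y z value≡2c , value≡2c

  fromSquareRoot : ∃ (IsSquareRootOf- F (c * p)) → ProperlyRepresents F (+ (2 * c))
  fromSquareRoot (α , α²≡-cp) = proper
    (squareRoot⇒representation F p-prime disc≡p c (ℕ.<-trans (ℕ.n<1+n 2) 3<p) {α} α²≡-cp)

  from : Oriented → ProperlyRepresents F (+ (2 * c))
  from (inj₁ f)       = fromSquareRoot
    (oriented⇒squareRoot {F = F} End≅Clf⁰ (c * p) {0ℤ} {+ (c * p)} (0ℤ , 1ℤ) (√-n-square (c * p)) f)
  from (inj₂ (d , f)) = fromSquareRoot
    (oriented⇒squareRoot {F = F} End≅Clf⁰ (c * p) {1ℤ} {+ quotient d} (ℤ.-1ℤ , + 2) (2θ-1-square (c * p) d) f)
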